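{- For $n\ge2$, $$\mathbf{cf}_{n,2}(p,q)|_{p^0}=q^{\binom{n-1}{2}}[n-1]_q.$$ Moreover, $\mathbf{cf}_{4,2}(p,q)|_{p^1}=q^2+q^3$, and for $n\ge5$, $$\mathbf{cf}_{n,2}(p,q)|_{p^1}=\binom{n-2}{2}q^{\binom{n}{2}-3}+q^{\binom{n-1}{2}-2}\sum_{i=0}^{n-3}\left(\binom{n-3}{2}+i\right)q^i.$$
   Context: $F_1(p,q)=q$, $F_2(p,q)=q^2$ and $F_m(p,q)=qF_{m-1}(p,q)+pF_{m-2}(p,q)$ for $m\ge3$. Let $(x)_{\uparrow_{F,p,q,0}}=1$ and $(x)_{\uparrow_{F,p,q,k}}=x(x+F_1(p,q))\cdots(x+F_{k-1}(p,q))$ for $k\ge1$. Define the polynomials $\mathbf{cf}_{n,k}(p,q)$ for $0\le k\le n$ by $(x)_{\uparrow_{F,p,q,n}}=\sum_{k=0}^n\mathbf{cf}_{n,k}(p,q)x^k$. For a polynomial $f$ in $p$ with coefficients in $\mathbb{Q}[q]$, $f|_{p^s}$ denotes the coefficient of $p^s$. $[m]_q=1+q+\cdots+q^{m-1}$. -}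

module Defs where

open import Algebra.Bundles.Raw using (RawRing)
import Algebra.Definitions.RawSemiring as RawSemiringDefinitions
open import Data.Fin.Base using (toℕ)
open import Data.List.Base using (List; []; _∷_; map)
open import Data.Nat.Base using (ℕ; zero; suc)
open import Data.Rational.Base using (+-*-rawRing)
open import Level using (0ℓ)

-- Univariate polynomials as coefficient lists, constant term first.
-- Lists differing by trailing zeros denote the same polynomial, so
-- equality is coefficientwise.

module Polynomial {c ℓ} (R : RawRing c ℓ) where

  private module R = RawRing R

  Poly : Set c
  Poly = List R.Carrier

  coeff : Poly → ℕ → R.Carrier
  coeff []      _       = R.0#
  coeff (a ∷ _) zero    = a
  coeff (_ ∷ f) (suc k) = coeff f k

  infix 4 _≈ₚ_
  _≈ₚ_ : Poly → Poly → Set ℓ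
  f ≈ₚ g = ∀ k → coeff f k R.≈ coeff g k

  infixl 6 _+ₚ_
  _+ₚ_ : Poly → Poly → Poly
  []      +ₚ g       = g
  (a ∷ f) +ₚ []      = a ∷ f
  (a ∷ f) +ₚ (b ∷ g) = (a R.+ b) ∷ (f +ₚ g)

  infixl 7 _*ₚ_
  _*ₚ_ : Poly → Poly → Poly
  []      *ₚ g = []
  (a ∷ f) *ₚ g = map (a R.*_) g +ₚ (R.0# ∷ (f *ₚ g))

  const : R.Carrier → Poly
  const a = a ∷ []

  var : Poly
  var = R.0# ∷ R.1# ∷ []

  rawRing : RawRing c ℓ
  rawRing = record
    { Carrier = Poly
    ; _≈_     = _≈ₚ_
    ; _+_     = _+ₚ_
    ; _*_     = _*ₚ_
    ; -_      = map R.-_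
    ; 0#      = []
    ; 1#      = const R.1#
    }

ℚ[q] : RawRing 0ℓ 0ℓ
ℚ[q] = Polynomial.rawRing +-*-rawRing

ℚ[q][p] : RawRing 0ℓ 0ℓ
ℚ[q][p] = Polynomial.rawRing ℚ[q]

ℚ[q][p][x] : RawRing 0ℓ 0ℓ
ℚ[q][p][x] = Polynomial.rawRing ℚ[q][p]

q : RawRing.Carrier ℚ[q]
q = Polynomial.var +-*-rawRing

module _ where
  open RawRing ℚ[q][p] using (Carrier; _+_; _*_; 0#)
  open RawSemiringDefinitions (RawRing.rawSemiring ℚ[q][p]) using (_^_)
  open Polynomial ℚ[q] using (const; var)

  -- F 0 is a dummy value; nothing below refers to it.
  F : ℕ → Carrier
  F 0                   = 0#
  F 1                   = const q
  F 2                   = const q ^ 2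
  F (suc (suc (suc m))) = const q * F (suc (suc m)) + var * F (suc m)

module _ where
  open RawRing ℚ[q][p][x] using (Carrier; _+_; _*_; 1#)
  open Polynomial ℚ[q][p] using (const)

  infixl 8 _↑_
  _↑_ : Carrier → ℕ → Carrier
  y ↑ 0           = 1#
  y ↑ 1           = y
  y ↑ suc (suc k) = y ↑ suc k * (y + const (F (suc k)))

cf : ℕ → ℕ → RawRing.Carrier ℚ[q][p]
cf n k = coeff (var ↑ n) k
  where open Polynomial ℚ[q][p] using (coeff; var)

infixl 5 _∣p^_
_∣p^_ : RawRing.Carrier ℚ[q][p] → ℕ → RawRing.Carrier ℚ[q]
f ∣p^ s = Polynomial.coeff ℚ[q] f s

-- The exported operators are those of ℚ[q]; _·_ is repeated addition.

open RawRing ℚ[q] public using (_≈_; _+_; _*_)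
open RawSemiringDefinitions (RawRing.rawSemiring ℚ[q]) public
  using (_^_; sum) renaming (_×_ to _·_)

[_]q : ℕ → RawRing.Carrier ℚ[q]
[ m ]q = sum {m} (λ i → q ^ toℕ i)

{-# OPTIONS --safe #-}

-- Expanding the product x (x + F₁) ⋯ (x + F₍ₙ₋₁₎) one factor at a time gives
-- cf₍ₙ₊₁,ₖ₎ = cf₍ₙ,ₖ₎ Fₙ + cf₍ₙ,ₖ₋₁₎.  Modulo p² one has
-- Fₘ = qᵐ + (m − 2) qᵐ⁻² p for m ≥ 2, so the coefficients of p⁰ and p¹ in
-- cf₍ₙ,₁₎ and cf₍ₙ,₂₎ satisfy linear recurrences over ℚ[q], and the closed
-- forms follow by induction on n.

module Submission where

open import Defs hiding (_≈_; _+_; _*_; _^_; _·_; sum; q)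
open import Algebra.Bundles using (CommutativeRing; CommutativeSemiring)
open import Algebra.Bundles.Raw using (RawRing)
open import Algebra.Structures using (IsCommutativeMonoid; IsCommutativeSemiring)
open import Algebra.Structures.Biased using (isCommutativeSemiringˡ)
import Algebra.Properties.Semiring.Exp as SemiringExp
import Algebra.Properties.Semiring.Mult as SemiringMult
import Algebra.Properties.Semiring.Sum as SemiringSum
import Algebra.Solver.Ring.NaturalCoefficients.Default as CommutativeSemiringSolver
open import Data.Fin.Base using (toℕ)
open import Data.List.Base using ([]; _∷_; map)
open import Data.Nat.Base using (ℕ; zero; suc; _∸_; _≤_; s≤s) renaming (_+_ to _+ℕ_)
open import Data.Nat.Combinatorics using (_C_; nC1≡n; nCk+nC[k+1]≡[n+1]C[k+1])
import Data.Nat.Properties as ℕₚ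
open import Data.Product.Base using (_×_; _,_)
open import Data.Rational.Base using (+-*-rawRing)
open import Data.Rational.Properties using (+-*-commutativeRing)
open import Level using (0ℓ; _⊔_)
open import Relation.Binary.PropositionalEquality.Core as ≡ using (_≡_)
import Relation.Binary.Reasoning.Setoid as SetoidReasoning

-- Arithmetic of coefficient lists over a commutative semiring.

FormsCommutativeSemiring : ∀ {c ℓ} → RawRing c ℓ → Set (c ⊔ ℓ)
FormsCommutativeSemiring R = IsCommutativeSemiring _≈_ _+_ _*_ 0# 1#
  where open RawRing R

module PolynomialSemiring {c ℓ} (R : RawRing c ℓ)
  (isCommutativeSemiring : FormsCommutativeSemiring R) where

  private
    semiring : CommutativeSemiring c ℓ
    semiring = record { isCommutativeSemiring = isCommutativeSemiring }

  open CommutativeSemiring semiring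
    hiding (semiring; isCommutativeSemiring)
  open SetoidReasoning setoid
  open CommutativeSemiringSolver semiring using (solve; con; _:+_; _:*_; _:=_)
  open Polynomial R hiding (rawRing)

  coeff-+ : ∀ f g k → coeff (f +ₚ g) k ≈ coeff f k + coeff g k
  coeff-+ []      g       k       = sym (+-identityˡ _)
  coeff-+ (a ∷ f) []      k       = sym (+-identityʳ _)
  coeff-+ (a ∷ f) (b ∷ g) zero    = refl
  coeff-+ (a ∷ f) (b ∷ g) (suc k) = coeff-+ f g k

  coeff-scale : ∀ a f k → coeff (map (a *_) f) k ≈ a * coeff f k
  coeff-scale a []      k       = sym (zeroʳ a)
  coeff-scale a (b ∷ f) zero    = refl
  coeff-scale a (b ∷ f) (suc k) = coeff-scale a f k

  -- This is (a + t f) g = a g + t (f g) read off coefficientwise, the unfolding rule behind the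
  -- inductions on the left factor below.
  coeff-∷-* : ∀ a f g k →
    coeff ((a ∷ f) *ₚ g) k ≈ a * coeff g k + coeff (0# ∷ (f *ₚ g)) k
  coeff-∷-* a f g k = trans
    (coeff-+ (map (a *_) g) (0# ∷ (f *ₚ g)) k)
    (+-congʳ (coeff-scale a g k))

  coeff-*-zero : ∀ f g → coeff (f *ₚ g) 0 ≈ coeff f 0 * coeff g 0
  coeff-*-zero []      g = sym (zeroˡ _)
  coeff-*-zero (a ∷ f) g = trans (coeff-∷-* a f g 0) (+-identityʳ _)

  coeff-*-one : ∀ f g →
    coeff (f *ₚ g) 1 ≈ coeff f 0 * coeff g 1 + coeff f 1 * coeff g 0
  coeff-*-one []      g = solve 2 (λ x y → con 0 := con 0 :* x :+ con 0 :* y)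
    refl (coeff g 1) (coeff g 0)
  coeff-*-one (a ∷ f) g = trans (coeff-∷-* a f g 1) (+-congˡ (coeff-*-zero f g))

  coeff-*-[] : ∀ f k → coeff (f *ₚ []) k ≈ 0#
  coeff-*-[] []      k       = refl
  coeff-*-[] (a ∷ f) zero    = refl
  coeff-*-[] (a ∷ f) (suc k) = coeff-*-[] f k

  -- Multiplication recurses on its left factor; this is the mirror-image recursion on the right
  -- factor, which is what commutativity requires.
  coeff-*-∷ : ∀ f b g k →
    coeff (f *ₚ (b ∷ g)) (suc k) ≈ coeff f (suc k) * b + coeff (f *ₚ g) k
  coeff-*-∷ []      b g k       = sym (trans (+-identityʳ _) (zeroˡ b))
  coeff-*-∷ (a ∷ f) b g zero    = begin
    coeff ((a ∷ f) *ₚ (b ∷ g)) 1             ≈⟨ coeff-*-one (a ∷ f) (b ∷ g) ⟩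
    a * coeff g 0 + coeff f 0 * b            ≈⟨ +-comm _ _ ⟩
    coeff f 0 * b + a * coeff g 0            ≈⟨ +-congˡ (coeff-*-zero (a ∷ f) g) ⟨
    coeff f 0 * b + coeff ((a ∷ f) *ₚ g) 0   ∎
  coeff-*-∷ (a ∷ f) b g (suc k) = begin
    coeff ((a ∷ f) *ₚ (b ∷ g)) (suc (suc k))
      ≈⟨ coeff-∷-* a f (b ∷ g) (suc (suc k)) ⟩
    a * coeff g (suc k) + coeff (f *ₚ (b ∷ g)) (suc k)
      ≈⟨ +-congˡ (coeff-*-∷ f b g k) ⟩
    a * coeff g (suc k) + (coeff f (suc k) * b + coeff (f *ₚ g) k)
      ≈⟨ solve 3 (λ x y z → x :+ (y :+ z) := y :+ (x :+ z)) refl _ _ _ ⟩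
    coeff f (suc k) * b + (a * coeff g (suc k) + coeff (f *ₚ g) k)
      ≈⟨ +-congˡ (coeff-∷-* a f g (suc k)) ⟨
    coeff f (suc k) * b + coeff ((a ∷ f) *ₚ g) (suc k) ∎

  *ₚ-comm : ∀ f g → f *ₚ g ≈ₚ g *ₚ f
  *ₚ-comm []      g k       = sym (coeff-*-[] g k)
  *ₚ-comm (a ∷ f) g zero    = begin
    coeff ((a ∷ f) *ₚ g) 0   ≈⟨ coeff-*-zero (a ∷ f) g ⟩
    a * coeff g 0            ≈⟨ *-comm _ _ ⟩
    coeff g 0 * a            ≈⟨ coeff-*-zero g (a ∷ f) ⟨
    coeff (g *ₚ (a ∷ f)) 0   ∎
  *ₚ-comm (a ∷ f) g (suc k) = begin
    coeff ((a ∷ f) *ₚ g) (suc k)               ≈⟨ coeff-∷-* a f g (suc k) ⟩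
    a * coeff g (suc k) + coeff (f *ₚ g) k     ≈⟨ +-cong (*-comm _ _) (*ₚ-comm f g k) ⟩
    coeff g (suc k) * a + coeff (g *ₚ f) k     ≈⟨ coeff-*-∷ g a f k ⟨
    coeff (g *ₚ (a ∷ f)) (suc k)               ∎

  *ₚ-distribʳ-+ₚ : ∀ h f g → (f +ₚ g) *ₚ h ≈ₚ (f *ₚ h) +ₚ (g *ₚ h)
  *ₚ-distribʳ-+ₚ h f g k = trans (pointwise f g k) (sym (coeff-+ (f *ₚ h) (g *ₚ h) k))
    where
    -- Phrased with a sum of coefficients instead of a coefficient of a sum, so that the induction
    -- hypothesis enters the solver's identity directly.
    pointwise : ∀ f g k →
      coeff ((f +ₚ g) *ₚ h) k ≈ coeff (f *ₚ h) k + coeff (g *ₚ h) k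
    pointwise []      g       k       = sym (+-identityˡ _)
    pointwise (a ∷ f) []      k       = sym (+-identityʳ _)
    pointwise (a ∷ f) (b ∷ g) zero    = begin
      coeff (((a ∷ f) +ₚ (b ∷ g)) *ₚ h) 0
        ≈⟨ coeff-*-zero ((a ∷ f) +ₚ (b ∷ g)) h ⟩
      (a + b) * coeff h 0
        ≈⟨ distribʳ _ _ _ ⟩
      a * coeff h 0 + b * coeff h 0
        ≈⟨ +-cong (coeff-*-zero (a ∷ f) h) (coeff-*-zero (b ∷ g) h) ⟨
      coeff ((a ∷ f) *ₚ h) 0 + coeff ((b ∷ g) *ₚ h) 0 ∎
    pointwise (a ∷ f) (b ∷ g) (suc k) = begin
      coeff (((a ∷ f) +ₚ (b ∷ g)) *ₚ h) (suc k)
        ≈⟨ coeff-∷-* (a + b) (f +ₚ g) h (suc k) ⟩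
      (a + b) * coeff h (suc k) + coeff ((f +ₚ g) *ₚ h) k
        ≈⟨ +-congˡ (pointwise f g k) ⟩
      (a + b) * coeff h (suc k) + (coeff (f *ₚ h) k + coeff (g *ₚ h) k)
        ≈⟨ solve 5 (λ a b x y z →
             (a :+ b) :* x :+ (y :+ z) := (a :* x :+ y) :+ (b :* x :+ z))
             refl a b _ _ _ ⟩
      (a * coeff h (suc k) + coeff (f *ₚ h) k) + (b * coeff h (suc k) + coeff (g *ₚ h) k)
        ≈⟨ +-cong (coeff-∷-* a f h (suc k)) (coeff-∷-* b g h (suc k)) ⟨
      coeff ((a ∷ f) *ₚ h) (suc k) + coeff ((b ∷ g) *ₚ h) (suc k) ∎

  scale-*ₚ : ∀ a f g k → coeff (map (a *_) f *ₚ g) k ≈ a * coeff (f *ₚ g) k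
  scale-*ₚ a []      g k       = sym (zeroʳ a)
  scale-*ₚ a (b ∷ f) g zero    = begin
    coeff (map (a *_) (b ∷ f) *ₚ g) 0   ≈⟨ coeff-*-zero (map (a *_) (b ∷ f)) g ⟩
    (a * b) * coeff g 0                 ≈⟨ *-assoc _ _ _ ⟩
    a * (b * coeff g 0)                 ≈⟨ *-congˡ (coeff-*-zero (b ∷ f) g) ⟨
    a * coeff ((b ∷ f) *ₚ g) 0          ∎
  scale-*ₚ a (b ∷ f) g (suc k) = begin
    coeff (map (a *_) (b ∷ f) *ₚ g) (suc k)
      ≈⟨ coeff-∷-* (a * b) (map (a *_) f) g (suc k) ⟩
    (a * b) * coeff g (suc k) + coeff (map (a *_) f *ₚ g) k
      ≈⟨ +-congˡ (scale-*ₚ a f g k) ⟩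
    (a * b) * coeff g (suc k) + a * coeff (f *ₚ g) k
      ≈⟨ solve 4 (λ a b x y → (a :* b) :* x :+ a :* y := a :* (b :* x :+ y)) refl a b _ _ ⟩
    a * (b * coeff g (suc k) + coeff (f *ₚ g) k)
      ≈⟨ *-congˡ (coeff-∷-* b f g (suc k)) ⟨
    a * coeff ((b ∷ f) *ₚ g) (suc k) ∎

  -- Writing the left factor as a + t f, distributivity and `scale-*ₚ` reduce the claim to the tail
  -- f, one degree lower.
  *ₚ-assoc : ∀ f g h → (f *ₚ g) *ₚ h ≈ₚ f *ₚ (g *ₚ h)
  *ₚ-assoc []      g h k = refl
  *ₚ-assoc (a ∷ f) g h k = begin
    coeff ((map (a *_) g +ₚ (0# ∷ (f *ₚ g))) *ₚ h) k
      ≈⟨ *ₚ-distribʳ-+ₚ h (map (a *_) g) (0# ∷ (f *ₚ g)) k ⟩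
    coeff ((map (a *_) g *ₚ h) +ₚ ((0# ∷ (f *ₚ g)) *ₚ h)) k
      ≈⟨ coeff-+ (map (a *_) g *ₚ h) ((0# ∷ (f *ₚ g)) *ₚ h) k ⟩
    coeff (map (a *_) g *ₚ h) k + coeff ((0# ∷ (f *ₚ g)) *ₚ h) k
      ≈⟨ +-cong (scale-*ₚ a g h k) (coeff-∷-* 0# (f *ₚ g) h k) ⟩
    a * coeff (g *ₚ h) k + (0# * coeff h k + coeff (0# ∷ ((f *ₚ g) *ₚ h)) k)
      ≈⟨ +-congˡ (trans (+-congʳ (zeroˡ _)) (+-identityˡ _)) ⟩
    a * coeff (g *ₚ h) k + coeff (0# ∷ ((f *ₚ g) *ₚ h)) k
      ≈⟨ +-congˡ (shift k) ⟩
    a * coeff (g *ₚ h) k + coeff (0# ∷ (f *ₚ (g *ₚ h))) k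
      ≈⟨ coeff-∷-* a f (g *ₚ h) k ⟨
    coeff ((a ∷ f) *ₚ (g *ₚ h)) k ∎
    where
    shift : 0# ∷ ((f *ₚ g) *ₚ h) ≈ₚ 0# ∷ (f *ₚ (g *ₚ h))
    shift zero    = refl
    shift (suc k) = *ₚ-assoc f g h k

  *ₚ-identityˡ : ∀ f → const 1# *ₚ f ≈ₚ f
  *ₚ-identityˡ f k = begin
    coeff (const 1# *ₚ f) k                ≈⟨ coeff-∷-* 1# [] f k ⟩
    1# * coeff f k + coeff (0# ∷ []) k     ≈⟨ +-cong (*-identityˡ _) (coeff-0 k) ⟩
    coeff f k + 0#                         ≈⟨ +-identityʳ _ ⟩
    coeff f k                              ∎
    where
    coeff-0 : 0# ∷ [] ≈ₚ []
    coeff-0 zero    = refl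
    coeff-0 (suc k) = refl

  *ₚ-congˡ : ∀ h {f g} → f ≈ₚ g → h *ₚ f ≈ₚ h *ₚ g
  *ₚ-congˡ []      f≈g k               = refl
  *ₚ-congˡ (a ∷ h) {f} {g} f≈g zero    = begin
    coeff ((a ∷ h) *ₚ f) 0   ≈⟨ coeff-*-zero (a ∷ h) f ⟩
    a * coeff f 0            ≈⟨ *-congˡ (f≈g 0) ⟩
    a * coeff g 0            ≈⟨ coeff-*-zero (a ∷ h) g ⟨
    coeff ((a ∷ h) *ₚ g) 0   ∎
  *ₚ-congˡ (a ∷ h) {f} {g} f≈g (suc k) = begin
    coeff ((a ∷ h) *ₚ f) (suc k)
      ≈⟨ coeff-∷-* a h f (suc k) ⟩
    a * coeff f (suc k) + coeff (h *ₚ f) k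
      ≈⟨ +-cong (*-congˡ (f≈g (suc k))) (*ₚ-congˡ h {f} {g} f≈g k) ⟩
    a * coeff g (suc k) + coeff (h *ₚ g) k
      ≈⟨ coeff-∷-* a h g (suc k) ⟨
    coeff ((a ∷ h) *ₚ g) (suc k) ∎

  -- Equal polynomials may be lists of different lengths, so induction on two equal left factors is
  -- awkward; commutativity moves each change to the right factor, where `*ₚ-congˡ` applies.
  *ₚ-cong : ∀ {f f′ g g′} → f ≈ₚ f′ → g ≈ₚ g′ → f *ₚ g ≈ₚ f′ *ₚ g′
  *ₚ-cong {f} {f′} {g} {g′} f≈f′ g≈g′ k = begin
    coeff (f *ₚ g) k     ≈⟨ *ₚ-congˡ f {g} {g′} g≈g′ k ⟩
    coeff (f *ₚ g′) k    ≈⟨ *ₚ-comm f g′ k ⟩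
    coeff (g′ *ₚ f) k    ≈⟨ *ₚ-congˡ g′ {f} {f′} f≈f′ k ⟩
    coeff (g′ *ₚ f′) k   ≈⟨ *ₚ-comm g′ f′ k ⟩
    coeff (f′ *ₚ g′) k   ∎

  +ₚ-isCommutativeMonoid : IsCommutativeMonoid _≈ₚ_ _+ₚ_ []
  +ₚ-isCommutativeMonoid = record
    { isMonoid = record
      { isSemigroup = record
        { isMagma = record
          { isEquivalence = record
            { refl  = λ k → refl
            ; sym   = λ f≈g k → sym (f≈g k)
            ; trans = λ f≈g g≈h k → trans (f≈g k) (g≈h k)
            }
          ; ∙-cong = λ {f} {f′} {g} {g′} f≈f′ g≈g′ k → begin
              coeff (f +ₚ g) k          ≈⟨ coeff-+ f g k ⟩
              coeff f k + coeff g k     ≈⟨ +-cong (f≈f′ k) (g≈g′ k) ⟩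
              coeff f′ k + coeff g′ k   ≈⟨ coeff-+ f′ g′ k ⟨
              coeff (f′ +ₚ g′) k        ∎
          }
        ; assoc = λ f g h k → begin
            coeff ((f +ₚ g) +ₚ h) k               ≈⟨ coeff-+ (f +ₚ g) h k ⟩
            coeff (f +ₚ g) k + coeff h k          ≈⟨ +-congʳ (coeff-+ f g k) ⟩
            (coeff f k + coeff g k) + coeff h k   ≈⟨ +-assoc _ _ _ ⟩
            coeff f k + (coeff g k + coeff h k)   ≈⟨ +-congˡ (coeff-+ g h k) ⟨
            coeff f k + coeff (g +ₚ h) k          ≈⟨ coeff-+ f (g +ₚ h) k ⟨
            coeff (f +ₚ (g +ₚ h)) k               ∎
        }
      ; identity =
          (λ f k → refl)
        , (λ f k → trans (coeff-+ f [] k) (+-identityʳ _))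
      }
    ; comm = λ f g k → begin
        coeff (f +ₚ g) k        ≈⟨ coeff-+ f g k ⟩
        coeff f k + coeff g k   ≈⟨ +-comm _ _ ⟩
        coeff g k + coeff f k   ≈⟨ coeff-+ g f k ⟨
        coeff (g +ₚ f) k        ∎
    }

  *ₚ-isCommutativeMonoid : IsCommutativeMonoid _≈ₚ_ _*ₚ_ (const 1#)
  *ₚ-isCommutativeMonoid = record
    { isMonoid = record
      { isSemigroup = record
        { isMagma = record
          { isEquivalence = IsCommutativeMonoid.isEquivalence +ₚ-isCommutativeMonoid
          ; ∙-cong        = λ {f} {f′} {g} {g′} → *ₚ-cong {f} {f′} {g} {g′}
          }
        ; assoc = *ₚ-assoc
        }
      ; identity =
          *ₚ-identityˡ
        , (λ f k → trans (*ₚ-comm f (const 1#) k) (*ₚ-identityˡ f k))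
      }
    ; comm = *ₚ-comm
    }

  +ₚ-*ₚ-isCommutativeSemiring :
    IsCommutativeSemiring _≈ₚ_ _+ₚ_ _*ₚ_ [] (const 1#)
  +ₚ-*ₚ-isCommutativeSemiring = isCommutativeSemiringˡ record
    { +-isCommutativeMonoid = +ₚ-isCommutativeMonoid
    ; *-isCommutativeMonoid = *ₚ-isCommutativeMonoid
    ; distribʳ              = *ₚ-distribʳ-+ₚ
    ; zeroˡ                 = λ f k → refl
    }

  -- Coefficients of a product with a linear factor, and of the right-hand side of the recurrence
  -- for `F`.

  coeff-*-linear : ∀ f a k →
    coeff (f *ₚ (var +ₚ const a)) (suc k) ≈ coeff f (suc k) * a + coeff f k
  coeff-*-linear f a k = begin
    -- The list `var +ₚ const a` computes to this one, so a single right-hand unfolding suffices.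
    coeff (f *ₚ ((0# + a) ∷ const 1#)) (suc k)
      ≈⟨ coeff-*-∷ f (0# + a) (const 1#) k ⟩
    coeff f (suc k) * (0# + a) + coeff (f *ₚ const 1#) k
      ≈⟨ +-cong (*-congˡ (+-identityˡ a))
                (trans (*ₚ-comm f (const 1#) k) (*ₚ-identityˡ f k)) ⟩
    coeff f (suc k) * a + coeff f k ∎

  coeff-const*+var*-zero : ∀ a f g →
    coeff (const a *ₚ f +ₚ var *ₚ g) 0 ≈ a * coeff f 0
  coeff-const*+var*-zero a f g = begin
    coeff (const a *ₚ f +ₚ var *ₚ g) 0
      ≈⟨ coeff-+ (const a *ₚ f) (var *ₚ g) 0 ⟩
    coeff (const a *ₚ f) 0 + coeff (var *ₚ g) 0
      ≈⟨ +-cong (coeff-*-zero (const a) f) (coeff-*-zero var g) ⟩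
    a * coeff f 0 + 0# * coeff g 0
      ≈⟨ trans (+-congˡ (zeroˡ _)) (+-identityʳ _) ⟩
    a * coeff f 0 ∎

  coeff-const*+var*-one : ∀ a f g →
    coeff (const a *ₚ f +ₚ var *ₚ g) 1 ≈ a * coeff f 1 + coeff g 0
  coeff-const*+var*-one a f g = begin
    coeff (const a *ₚ f +ₚ var *ₚ g) 1
      ≈⟨ coeff-+ (const a *ₚ f) (var *ₚ g) 1 ⟩
    coeff (const a *ₚ f) 1 + coeff (var *ₚ g) 1
      ≈⟨ +-cong (coeff-*-one (const a) f) (coeff-*-one var g) ⟩
    (a * coeff f 1 + 0# * coeff f 0) + (0# * coeff g 1 + 1# * coeff g 0)
      ≈⟨ solve 5 (λ a x y z w →
           (a :* x :+ con 0 :* y) :+ (con 0 :* z :+ con 1 :* w) := a :* x :+ w)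
           refl a _ _ _ _ ⟩
    a * coeff f 1 + coeff g 0 ∎

-- Polynomials in two variables: `P²` carries the outer variable x, `P` the inner variable p.

module BivariatePolynomials {c ℓ} (R : RawRing c ℓ)
  (isCommutativeSemiring : FormsCommutativeSemiring R) where

  open IsCommutativeSemiring isCommutativeSemiring
  open RawRing R using (_≈_; _+_; _*_; 0#)
  private
    module P  = Polynomial R
    module S  = PolynomialSemiring R isCommutativeSemiring
    module P² = Polynomial P.rawRing
    module S² = PolynomialSemiring P.rawRing S.+ₚ-*ₚ-isCommutativeSemiring

  -- Divisibility by x survives multiplication; this keeps the x⁰ coefficient of the rising
  -- factorials at zero.
  constantTerm-* : ∀ f g → P².coeff f 0 P.≈ₚ [] → P².coeff (f P².*ₚ g) 0 P.≈ₚ []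
  constantTerm-* f g f₀≈0 k = trans (S².coeff-*-zero f g k)
    (S.*ₚ-cong {P².coeff f 0} {[]} {P².coeff g 0} {P².coeff g 0} f₀≈0 (λ _ → refl) k)

  coeff²-*-linear-zero : ∀ f a k →
    P.coeff (P².coeff (f P².*ₚ (P².var P².+ₚ P².const a)) (suc k)) 0 ≈
    P.coeff (P².coeff f (suc k)) 0 * P.coeff a 0 + P.coeff (P².coeff f k) 0
  coeff²-*-linear-zero f a k = trans (S².coeff-*-linear f a k 0)
    (trans (S.coeff-+ (P².coeff f (suc k) P.*ₚ a) (P².coeff f k) 0)
           (+-congʳ (S.coeff-*-zero (P².coeff f (suc k)) a)))

  -- The product of the x-coefficient with a is taken modulo p², where the p¹ coefficient has two
  -- cross terms.
  coeff²-*-linear-one : ∀ f a k →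
    P.coeff (P².coeff (f P².*ₚ (P².var P².+ₚ P².const a)) (suc k)) 1 ≈
    (P.coeff (P².coeff f (suc k)) 0 * P.coeff a 1 +
     P.coeff (P².coeff f (suc k)) 1 * P.coeff a 0) + P.coeff (P².coeff f k) 1
  coeff²-*-linear-one f a k = trans (S².coeff-*-linear f a k 1)
    (trans (S.coeff-+ (P².coeff f (suc k) P.*ₚ a) (P².coeff f k) 1)
           (+-congʳ (S.coeff-*-one (P².coeff f (suc k)) a)))

  -- The case k = 0 for f divisible by x, where the contribution of x⁰ disappears; it yields the
  -- recurrence for `a₀`.
  coeff²-*-linear-zero′ : ∀ f a → P².coeff f 0 P.≈ₚ [] →
    P.coeff (P².coeff (f P².*ₚ (P².var P².+ₚ P².const a)) 1) 0 ≈
    P.coeff (P².coeff f 1) 0 * P.coeff a 0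
  coeff²-*-linear-zero′ f a f₀≈0 = trans (coeff²-*-linear-zero f a 0)
    (trans (+-congˡ (f₀≈0 0)) (+-identityʳ _))

  coeff²-*-linear-one′ : ∀ f a → P².coeff f 0 P.≈ₚ [] →
    P.coeff (P².coeff (f P².*ₚ (P².var P².+ₚ P².const a)) 1) 1 ≈
    P.coeff (P².coeff f 1) 0 * P.coeff a 1 + P.coeff (P².coeff f 1) 1 * P.coeff a 0
  coeff²-*-linear-one′ f a f₀≈0 = trans (coeff²-*-linear-one f a 0)
    (trans (+-congˡ (f₀≈0 1)) (+-identityʳ _))

-- Triangular numbers, and the recurrences over an abstract commutative semiring.

sucC2 : ∀ n → suc n C 2 ≡ n +ℕ n C 2
sucC2 n = ≡.trans (≡.sym (nCk+nC[k+1]≡[n+1]C[k+1] n 1)) (≡.cong (_+ℕ n C 2) (nC1≡n n))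

module ClosedForms {c ℓ} (S : CommutativeSemiring c ℓ)
  (q : CommutativeSemiring.Carrier S) where

  open CommutativeSemiring S
  open SemiringExp semiring using (_^_; ^-homo-*; ^-congʳ)
  open SemiringMult semiring
    using (×-homo-+; ×-assoc-*; ×-comm-*; ×-congʳ; ×-congˡ) renaming (_×_ to _·_)
  open SemiringSum semiring
    using (sum; sum-cong-≋; ∑-distrib-+; *-distribˡ-sum)
  open SetoidReasoning setoid
  open CommutativeSemiringSolver S using (solve; con; _:+_; _:*_; _:=_)

  -- Index m stands for n = m + 1, so φ₀ m and φ₁ m are the coefficients of p⁰
  -- and p¹ in F (m + 1), and likewise a for cf (m + 1) 1 and b for cf (m + 1) 2.
  record Recurrences (φ₀ φ₁ a₀ a₁ b₀ b₁ : ℕ → Carrier) : Set ℓ where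
    field
      φ₀-0   : φ₀ 0 ≈ q
      φ₀-1   : φ₀ 1 ≈ q ^ 2
      φ₀-suc : ∀ m → φ₀ (2 +ℕ m) ≈ q * φ₀ (1 +ℕ m)
      φ₁-0   : φ₁ 0 ≈ 0#
      φ₁-1   : φ₁ 1 ≈ 0#
      φ₁-suc : ∀ m → φ₁ (2 +ℕ m) ≈ q * φ₁ (1 +ℕ m) + φ₀ m
      a₀-0   : a₀ 0 ≈ 1#
      a₀-suc : ∀ m → a₀ (suc m) ≈ a₀ m * φ₀ m
      a₁-0   : a₁ 0 ≈ 0#
      a₁-suc : ∀ m → a₁ (suc m) ≈ a₀ m * φ₁ m + a₁ m * φ₀ m
      b₀-0   : b₀ 0 ≈ 0#
      b₀-suc : ∀ m → b₀ (suc m) ≈ b₀ m * φ₀ m + a₀ m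
      b₁-0   : b₁ 0 ≈ 0#
      b₁-suc : ∀ m → b₁ (suc m) ≈ (b₀ m * φ₁ m + b₁ m * φ₀ m) + a₁ m

  -- Sums of powers of q: the q-integer and the weighted sum of the p¹ formula.

  ⟨_⟩ : ℕ → Carrier
  ⟨ m ⟩ = sum {m} (λ i → q ^ toℕ i)

  shiftedSum : ℕ → ℕ → Carrier
  shiftedSum c m = sum {m} (λ i → (c +ℕ toℕ i) · (q ^ toℕ i))

  -- Turns a natural multiple into a product, so that the solver can treat `n · 1#` as an atom.
  ·-as-* : ∀ n x → n · x ≈ (n · 1#) * x
  ·-as-* n x = sym (trans (×-assoc-* n 1# x) (×-congʳ n (*-identityˡ x)))

  ⟨suc⟩ : ∀ m → ⟨ suc m ⟩ ≈ 1# + q * ⟨ m ⟩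
  ⟨suc⟩ m = +-congˡ (sym (*-distribˡ-sum {m} q (λ i → q ^ toℕ i)))

  ⟨suc⟩-last : ∀ m → ⟨ suc m ⟩ ≈ ⟨ m ⟩ + q ^ m
  ⟨suc⟩-last zero    = +-comm _ _
  ⟨suc⟩-last (suc m) = begin
    ⟨ suc (suc m) ⟩                ≈⟨ ⟨suc⟩ (suc m) ⟩
    1# + q * ⟨ suc m ⟩             ≈⟨ +-congˡ (*-congˡ (⟨suc⟩-last m)) ⟩
    1# + q * (⟨ m ⟩ + q ^ m)       ≈⟨ solve 3 (λ q x y →
                                        con 1 :+ q :* (x :+ y) := (con 1 :+ q :* x) :+ q :* y)
                                        refl q _ _ ⟩
    (1# + q * ⟨ m ⟩) + q ^ suc m   ≈⟨ +-congʳ (⟨suc⟩ m) ⟨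
    ⟨ suc m ⟩ + q ^ suc m          ∎

  shiftedSum-+ : ∀ d c m → shiftedSum (d +ℕ c) m ≈ (d · 1#) * ⟨ m ⟩ + shiftedSum c m
  shiftedSum-+ d c m = begin
    shiftedSum (d +ℕ c) m
      ≈⟨ sum-cong-≋ {m} (λ i → trans (×-congˡ (ℕₚ.+-assoc d c (toℕ i)))
           (trans (×-homo-+ _ d (c +ℕ toℕ i)) (+-congʳ (·-as-* d _)))) ⟩
    sum {m} (λ i → (d · 1#) * q ^ toℕ i + (c +ℕ toℕ i) · (q ^ toℕ i))
      ≈⟨ ∑-distrib-+ {m} (λ i → (d · 1#) * q ^ toℕ i) _ ⟩
    sum {m} (λ i → (d · 1#) * q ^ toℕ i) + shiftedSum c m
      ≈⟨ +-congʳ (*-distribˡ-sum {m} (d · 1#) (λ i → q ^ toℕ i)) ⟨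
    (d · 1#) * ⟨ m ⟩ + shiftedSum c m ∎

  -- Split off the term i = 0 and take one q out of the others; the reindexing raises the offset c
  -- by one.
  shiftedSum-suc : ∀ c m → shiftedSum c (suc m) ≈ c · 1# + q * shiftedSum (suc c) m
  shiftedSum-suc c m = +-cong (×-congˡ (ℕₚ.+-identityʳ c)) (begin
    sum {m} (λ i → (c +ℕ suc (toℕ i)) · (q * q ^ toℕ i))
      ≈⟨ sum-cong-≋ {m} (λ i → trans (×-congˡ (ℕₚ.+-suc c (toℕ i)))
           (sym (×-comm-* (suc c +ℕ toℕ i) q (q ^ toℕ i)))) ⟩
    sum {m} (λ i → q * ((suc c +ℕ toℕ i) · (q ^ toℕ i)))
      ≈⟨ *-distribˡ-sum {m} q (λ i → (suc c +ℕ toℕ i) · (q ^ toℕ i)) ⟨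
    q * shiftedSum (suc c) m ∎)

  ^-sucC2 : ∀ n → q ^ (suc n C 2) ≈ q ^ n * q ^ (n C 2)
  ^-sucC2 n = trans (^-congʳ q (sucC2 n)) (^-homo-* q n (n C 2))

  ·-sucC2 : ∀ n → (suc n C 2) · 1# ≈ n · 1# + (n C 2) · 1#
  ·-sucC2 n = trans (×-congˡ (sucC2 n)) (×-homo-+ 1# n (n C 2))

  *-0+0-* : ∀ {x y z w} → y ≈ 0# → z ≈ 0# → x * y + z * w ≈ 0#
  *-0+0-* {x} {y} {z} {w} y≈0 z≈0 = begin
    x * y + z * w     ≈⟨ +-cong (*-congˡ y≈0) (*-congʳ z≈0) ⟩
    x * 0# + 0# * w   ≈⟨ +-cong (zeroʳ x) (zeroˡ w) ⟩
    0# + 0#           ≈⟨ +-identityˡ 0# ⟩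
    0#                ∎

  -- Solving the recurrences by induction.

  module _ {φ₀ φ₁ a₀ a₁ b₀ b₁ : ℕ → Carrier}
    (recurrences : Recurrences φ₀ φ₁ a₀ a₁ b₀ b₁) where

    open Recurrences recurrences

    φ₀-closed : ∀ m → φ₀ m ≈ q ^ suc m
    φ₀-closed 0             = trans φ₀-0 (sym (*-identityʳ q))
    φ₀-closed 1             = φ₀-1
    φ₀-closed (suc (suc m)) = trans (φ₀-suc m) (*-congˡ (φ₀-closed (suc m)))

    -- The truncated subtraction only affects m = 0, where the coefficient is 0.
    φ₁-closed : ∀ m → φ₁ m ≈ (m ∸ 1) · (q ^ (m ∸ 1))
    φ₁-closed 0             = φ₁-0
    φ₁-closed 1             = φ₁-1
    φ₁-closed (suc (suc m)) = begin
      φ₁ (2 +ℕ m)                      ≈⟨ φ₁-suc m ⟩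
      q * φ₁ (1 +ℕ m) + φ₀ m           ≈⟨ +-cong (*-congˡ (φ₁-closed (suc m))) (φ₀-closed m) ⟩
      q * (m · (q ^ m)) + q ^ suc m    ≈⟨ +-congʳ (×-comm-* m q _) ⟩
      m · (q ^ suc m) + q ^ suc m      ≈⟨ +-comm _ _ ⟩
      suc m · (q ^ suc m)              ∎

    -- At p⁰ the coefficient is the product of q¹, ..., qᵐ, and 1 + ⋯ + m is the binomial
    -- coefficient in the exponent.
    a₀-closed : ∀ m → a₀ m ≈ q ^ (suc m C 2)
    a₀-closed zero    = a₀-0
    a₀-closed (suc m) = begin
      a₀ (suc m)                     ≈⟨ a₀-suc m ⟩
      a₀ m * φ₀ m                    ≈⟨ *-cong (a₀-closed m) (φ₀-closed m) ⟩
      q ^ (suc m C 2) * q ^ suc m    ≈⟨ *-comm _ _ ⟩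
      q ^ suc m * q ^ (suc m C 2)    ≈⟨ ^-sucC2 (suc m) ⟨
      q ^ (suc (suc m) C 2)          ∎

    b₀-closed : ∀ m → b₀ m ≈ q ^ (m C 2) * ⟨ m ⟩
    b₀-closed zero    = trans b₀-0 (sym (zeroʳ _))
    b₀-closed (suc m) = begin
      b₀ (suc m)
        ≈⟨ b₀-suc m ⟩
      b₀ m * φ₀ m + a₀ m
        -- Splitting the exponent of `a₀ m` exposes the factor shared by both summands; what remains
        -- is 1 + q ⟨m⟩, the next q-integer.
        ≈⟨ +-cong (*-cong (b₀-closed m) (φ₀-closed m)) (trans (a₀-closed m) (^-sucC2 m)) ⟩
      (q ^ (m C 2) * ⟨ m ⟩) * q ^ suc m + q ^ m * q ^ (m C 2)
        ≈⟨ solve 4 (λ q x y z →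
             (x :* y) :* (q :* z) :+ z :* x := (z :* x) :* (con 1 :+ q :* y))
             refl q _ _ _ ⟩
      (q ^ m * q ^ (m C 2)) * (1# + q * ⟨ m ⟩)
        ≈⟨ *-cong (^-sucC2 m) (⟨suc⟩ m) ⟨
      q ^ (suc m C 2) * ⟨ suc m ⟩ ∎

    b₀-2 : b₀ 2 ≈ q + q ^ 2
    b₀-2 = trans (b₀-closed 2)
      (solve 1 (λ q → (q :* con 1) :* (con 1 :+ (q :* con 1 :+ con 0)) := q :+ q :* (q :* con 1)) refl q)

    -- The variable p first appears in F₃, hence not in the rising factorials with n ≤ 3.
    a₁-1 : a₁ 1 ≈ 0#
    a₁-1 = trans (a₁-suc 0) (*-0+0-* φ₁-0 a₁-0)

    a₁-2 : a₁ 2 ≈ 0#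
    a₁-2 = trans (a₁-suc 1) (*-0+0-* φ₁-1 a₁-1)

    -- The exponent is binom(m + 3, 2) − 2.
    a₁-closed : ∀ m → a₁ (2 +ℕ m) ≈ (suc m C 2) · (q ^ (m +ℕ (2 +ℕ m) C 2))
    a₁-closed zero    = a₁-2
    a₁-closed (suc m) = begin
      a₁ (3 +ℕ m)
        ≈⟨ a₁-suc (2 +ℕ m) ⟩
      a₀ (2 +ℕ m) * φ₁ (2 +ℕ m) + a₁ (2 +ℕ m) * φ₀ (2 +ℕ m)
        -- All powers are split into `q ^ m`, `Q` and explicit factors q, making the step a
        -- polynomial identity.
        ≈⟨ +-cong
             (*-cong (trans (a₀-closed (2 +ℕ m)) (^-sucC2 (2 +ℕ m)))
                     (trans (φ₁-closed (2 +ℕ m)) (·-as-* (suc m) _)))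
             (*-cong (trans (a₁-closed m) (trans (·-as-* (suc m C 2) _)
                       (*-congˡ (^-homo-* q m _))))
                     (φ₀-closed (2 +ℕ m))) ⟩
      ((q ^ (2 +ℕ m)) * Q) * (N * (q ^ suc m)) + (K * (q ^ m * Q)) * (q ^ (3 +ℕ m))
        ≈⟨ solve 5 (λ q z Q N K →
             ((q :* (q :* z)) :* Q) :* (N :* (q :* z)) :+ (K :* (z :* Q)) :* (q :* (q :* (q :* z)))
               := (N :+ K) :* ((q :* z) :* ((q :* (q :* z)) :* Q)))
             refl q (q ^ m) Q N K ⟩
      (N + K) * (q ^ suc m * (q ^ (2 +ℕ m) * Q))
        -- `N + K` is binom(m + 2, 2) by Pascal's rule.
        ≈⟨ *-cong (·-sucC2 (suc m))
             (trans (^-homo-* q (suc m) _) (*-congˡ (^-sucC2 (2 +ℕ m)))) ⟨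
      (((2 +ℕ m) C 2) · 1#) * q ^ (suc m +ℕ (3 +ℕ m) C 2)
        ≈⟨ ·-as-* ((2 +ℕ m) C 2) _ ⟨
      ((2 +ℕ m) C 2) · (q ^ (suc m +ℕ (3 +ℕ m) C 2)) ∎
      where
      Q N K : Carrier
      Q = q ^ ((2 +ℕ m) C 2)
      N = suc m · 1#
      K = (suc m C 2) · 1#

    b₁-1 : b₁ 1 ≈ 0#
    b₁-1 = trans (b₁-suc 0) (trans (+-cong (*-0+0-* φ₁-0 b₁-0) a₁-0) (+-identityˡ 0#))

    b₁-2 : b₁ 2 ≈ 0#
    b₁-2 = trans (b₁-suc 1) (trans (+-cong (*-0+0-* φ₁-1 b₁-1) a₁-1) (+-identityˡ 0#))

    -- For n = 4 only F₃ contains p, with coefficient q, and it multiplies the p⁰ part q + q² of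
    -- cf₍₃,₂₎.
    b₁-3 : b₁ 3 ≈ q ^ 2 + q ^ 3
    b₁-3 = begin
      b₁ 3
        ≈⟨ b₁-suc 2 ⟩
      (b₀ 2 * φ₁ 2 + b₁ 2 * φ₀ 2) + a₁ 2
        ≈⟨ +-cong (+-cong (*-cong b₀-2 (φ₁-closed 2)) (*-congʳ b₁-2)) a₁-2 ⟩
      ((q + q ^ 2) * (1 · (q ^ 1)) + 0# * φ₀ 2) + 0#
        ≈⟨ solve 2 (λ q x →
             ((q :+ q :* (q :* con 1)) :* (q :* con 1 :+ con 0) :+ con 0 :* x) :+ con 0
               := q :* (q :* con 1) :+ q :* (q :* (q :* con 1)))
             refl q _ ⟩
      q ^ 2 + q ^ 3 ∎

    -- The exponents are binom(m + 4, 2) − 3 and binom(m + 3, 2) − 2.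
    b₁-closed : ∀ m → b₁ (3 +ℕ m) ≈
      ((2 +ℕ m) C 2) · (q ^ (m +ℕ (3 +ℕ m) C 2))
      + q ^ (m +ℕ (2 +ℕ m) C 2) * shiftedSum (suc m C 2) (2 +ℕ m)
    -- The induction starts at n = 4, where the general expression evaluates to q³ + q · q.
    b₁-closed zero    = trans b₁-3
      (solve 1 (λ q → q :* (q :* con 1) :+ q :* (q :* (q :* con 1))
          := (q :* (q :* (q :* con 1)) :+ con 0) :+
             (q :* con 1) :* (con 0 :+ ((q :* con 1 :+ con 0) :+ con 0))) refl q)
    b₁-closed (suc m) = begin
      b₁ (4 +ℕ m)
        ≈⟨ b₁-suc (3 +ℕ m) ⟩
      (b₀ (3 +ℕ m) * φ₁ (3 +ℕ m) + b₁ (3 +ℕ m) * φ₀ (3 +ℕ m)) + a₁ (3 +ℕ m)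
        ≈⟨ +-cong (+-cong
             (*-cong (trans (b₀-closed (3 +ℕ m))
                       -- The last power of the q-integer is detached: multiplied by `N` it joins
                       -- `K` in the leading binomial coefficient, while `G` goes into the weighted
                       -- sum.
                       (*-cong (^-sucC2 (2 +ℕ m)) (⟨suc⟩-last (2 +ℕ m))))
                     (trans (φ₁-closed (3 +ℕ m)) (·-as-* (2 +ℕ m) _)))
             (*-cong (trans (b₁-closed m) (+-cong
                       (trans (·-as-* ((2 +ℕ m) C 2) _)
                         (*-congˡ (trans (^-homo-* q m _) (*-congˡ (^-sucC2 (2 +ℕ m))))))
                       (*-congʳ (^-homo-* q m _))))
                     (φ₀-closed (3 +ℕ m))))
             -- This summand becomes the term i = 0 of the new weighted sum, with coefficient `K`.
             (trans (a₁-closed (suc m)) (trans (·-as-* ((2 +ℕ m) C 2) _)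
               (*-congˡ (trans (^-homo-* q (suc m) _) (*-congˡ (^-sucC2 (2 +ℕ m))))))) ⟩
      (((q ^ (2 +ℕ m) * Q) * (G + q ^ (2 +ℕ m))) * (N * q ^ (2 +ℕ m))
        + (K * (q ^ m * (q ^ (2 +ℕ m) * Q)) + (q ^ m * Q) * Σ) * q ^ (4 +ℕ m))
        + K * (q ^ suc m * (q ^ (2 +ℕ m) * Q))
        ≈⟨ solve 7 (λ q z Q G Σ N K →
             let z₂ = q :* (q :* z)
                 z₃ = q :* z₂ in
             (((z₂ :* Q) :* (G :+ z₂)) :* (N :* z₂)
               :+ (K :* (z :* (z₂ :* Q)) :+ (z :* Q) :* Σ) :* (q :* z₃))
               :+ K :* ((q :* z) :* (z₂ :* Q))
             := (N :+ K) :* ((q :* z) :* (z₃ :* (z₂ :* Q)))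
               :+ ((q :* z) :* (z₂ :* Q)) :* (K :+ q :* (N :* G :+ Σ)))
             refl q (q ^ m) Q G Σ N K ⟩
      (N + K) * (q ^ suc m * (q ^ (3 +ℕ m) * (q ^ (2 +ℕ m) * Q)))
        + (q ^ suc m * (q ^ (2 +ℕ m) * Q)) * (K + q * (N * G + Σ))
        ≈⟨ +-cong
             (trans (·-as-* ((3 +ℕ m) C 2) _)
               (*-cong (·-sucC2 (2 +ℕ m))
                 (trans (^-homo-* q (suc m) _)
                   (*-congˡ (trans (^-sucC2 (3 +ℕ m)) (*-congˡ (^-sucC2 (2 +ℕ m))))))))
             (*-cong
               (trans (^-homo-* q (suc m) _) (*-congˡ (^-sucC2 (2 +ℕ m))))
               (trans (shiftedSum-suc ((2 +ℕ m) C 2) (2 +ℕ m))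
                 (+-congˡ (*-congˡ sum-step)))) ⟨
      ((3 +ℕ m) C 2) · (q ^ (suc m +ℕ (4 +ℕ m) C 2))
        + q ^ (suc m +ℕ (3 +ℕ m) C 2) * shiftedSum ((2 +ℕ m) C 2) (3 +ℕ m) ∎
      where
      Q G Σ N K : Carrier
      Q = q ^ ((2 +ℕ m) C 2)
      G = ⟨ 2 +ℕ m ⟩
      Σ = shiftedSum (suc m C 2) (2 +ℕ m)
      N = (2 +ℕ m) · 1#
      K = ((2 +ℕ m) C 2) · 1#

      -- Pascal's rule raises the offset by m + 1 and the reindexing by one more: m + 2 in all,
      -- which is the multiple `N` of `G`.
      sum-step : shiftedSum (suc ((2 +ℕ m) C 2)) (2 +ℕ m) ≈ N * G + Σ
      sum-step = trans
        (reflexive (≡.cong (λ c → shiftedSum (suc c) (2 +ℕ m)) (sucC2 (suc m))))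
        (shiftedSum-+ (2 +ℕ m) (suc m C 2) (2 +ℕ m))

    -- Pascal's rule puts a visible 3 + m or 2 + m in front of each binomial coefficient, from which
    -- the truncated subtraction computes.
    b₁-closed-∸ : ∀ m → b₁ (3 +ℕ m) ≈
      ((2 +ℕ m) C 2) · (q ^ ((4 +ℕ m) C 2 ∸ 3))
      + q ^ ((3 +ℕ m) C 2 ∸ 2) * shiftedSum (suc m C 2) (2 +ℕ m)
    b₁-closed-∸ m = trans (b₁-closed m) (sym (+-cong
      (×-congʳ ((2 +ℕ m) C 2) (^-congʳ q (≡.cong (_∸ 3) (sucC2 (3 +ℕ m)))))
      (*-congʳ (^-congʳ q (≡.cong (_∸ 2) (sucC2 (2 +ℕ m)))))))

-- Specialization to ℚ[q] and the theorem.

open Defs using (_≈_; _+_; _*_; _^_; _·_; sum; q)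

private
  module ℚPolynomials = PolynomialSemiring +-*-rawRing
    (CommutativeRing.isCommutativeSemiring +-*-commutativeRing)
  module ℚ[q]Polynomials = PolynomialSemiring ℚ[q] ℚPolynomials.+ₚ-*ₚ-isCommutativeSemiring
  module ℚ[q][p]Polynomials =
    BivariatePolynomials ℚ[q] ℚPolynomials.+ₚ-*ₚ-isCommutativeSemiring

ℚ[q]-commutativeSemiring : CommutativeSemiring 0ℓ 0ℓ
ℚ[q]-commutativeSemiring = record
  { isCommutativeSemiring = ℚPolynomials.+ₚ-*ₚ-isCommutativeSemiring }

rising : ℕ → RawRing.Carrier ℚ[q][p][x]
rising n = Polynomial.var ℚ[q][p] ↑ n

-- The first factor of a nonempty rising factorial is x.
cf-0 : ∀ m → RawRing._≈_ ℚ[q][p] (cf (suc m) 0) []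
cf-0 zero    = λ _ _ → ≡.refl
cf-0 (suc m) = ℚ[q][p]Polynomials.constantTerm-* (rising (suc m)) _ (cf-0 m)

open ClosedForms ℚ[q]-commutativeSemiring q

-- With n = m + 1 the index of `F` stays positive, and the rising factorial for n + 1 unfolds by
-- computation to the previous one times x + Fₙ.
cf-recurrences : Recurrences
  (λ m → F (suc m) ∣p^ 0) (λ m → F (suc m) ∣p^ 1)
  (λ m → cf (suc m) 1 ∣p^ 0) (λ m → cf (suc m) 1 ∣p^ 1)
  (λ m → cf (suc m) 2 ∣p^ 0) (λ m → cf (suc m) 2 ∣p^ 1)
cf-recurrences = record
  { φ₀-0   = λ _ → ≡.refl
  ; φ₀-1   = λ _ → ≡.refl
  ; φ₀-suc = λ m → ℚ[q]Polynomials.coeff-const*+var*-zero q (F (2 +ℕ m)) (F (1 +ℕ m))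
  ; φ₁-0   = λ _ → ≡.refl
  ; φ₁-1   = λ _ → ≡.refl
  ; φ₁-suc = λ m → ℚ[q]Polynomials.coeff-const*+var*-one q (F (2 +ℕ m)) (F (1 +ℕ m))
  ; a₀-0   = λ _ → ≡.refl
  ; a₀-suc = λ m →
      ℚ[q][p]Polynomials.coeff²-*-linear-zero′ (rising (suc m)) (F (suc m)) (cf-0 m)
  ; a₁-0   = λ _ → ≡.refl
  ; a₁-suc = λ m →
      ℚ[q][p]Polynomials.coeff²-*-linear-one′ (rising (suc m)) (F (suc m)) (cf-0 m)
  ; b₀-0   = λ _ → ≡.refl
  ; b₀-suc = λ m →
      ℚ[q][p]Polynomials.coeff²-*-linear-zero (rising (suc m)) (F (suc m)) 1
  ; b₁-0   = λ _ → ≡.refl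
  ; b₁-suc = λ m →
      ℚ[q][p]Polynomials.coeff²-*-linear-one (rising (suc m)) (F (suc m)) 1
  }

theorem15 : (∀ (n : ℕ) → 2 ≤ n →
    (cf n 2 ∣p^ 0) ≈ (q ^ ((n ∸ 1) C 2)) * [ n ∸ 1 ]q)
    × ((cf 4 2 ∣p^ 1) ≈ q ^ 2 + q ^ 3)
    × (∀ (n : ℕ) → 5 ≤ n →
    (cf n 2 ∣p^ 1) ≈
    (((n ∸ 2) C 2) · (q ^ ((n C 2) ∸ 3)))
    + (q ^ (((n ∸ 1) C 2) ∸ 2))
    * sum {n ∸ 2} (λ i → (((n ∸ 3) C 2) +ℕ toℕ i) · (q ^ toℕ i)))
theorem15 = p⁰-part , b₁-3 cf-recurrences , p¹-part
  where
  p⁰-part : ∀ n → 2 ≤ n → (cf n 2 ∣p^ 0) ≈ (q ^ ((n ∸ 1) C 2)) * [ n ∸ 1 ]q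
  p⁰-part (suc m) _ = b₀-closed cf-recurrences m

  p¹-part : ∀ n → 5 ≤ n → (cf n 2 ∣p^ 1) ≈
    (((n ∸ 2) C 2) · (q ^ ((n C 2) ∸ 3)))
    + (q ^ (((n ∸ 1) C 2) ∸ 2))
    * sum {n ∸ 2} (λ i → (((n ∸ 3) C 2) +ℕ toℕ i) · (q ^ toℕ i))
  -- Since `b₁` is indexed by n - 1, the value n = m + 4 corresponds to `b₁ (3 +ℕ m)`.
  p¹-part (suc (suc (suc (suc m)))) (s≤s (s≤s (s≤s (s≤s _)))) = b₁-closed-∸ cf-recurrences m
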